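{- Let $\mathcal X_1,\mathcal X_2,\mathcal Y_1,\mathcal Y_2$ be finite nonempty sets. For any jointly supported prior $\pi$ on $\mathcal X_1\times\mathcal X_2$ with marginals $\pi_1,\pi_2$, and any two channels $(\mathcal X_1,\mathcal Y_1,C_1)$ and $(\mathcal X_2,\mathcal Y_2,C_2)$: (1) $I_\infty(\pi,C_1\times C_2)\ \ge\ I_\infty(\pi_1,C_1)+I_\infty(\pi_2,C_2)-\log\frac{M^{\max}_{\infty,\pi}}{M^{\min}_{\infty,\pi}}$; (2) $I_\infty(\pi,C_1\times C_2)\ \le\ I_\infty(\pi_1,C_1)+I_\infty(\pi_2,C_2)+\log\frac{M^{\max}_{\infty,\pi}}{M^{\min}_{\infty,\pi}}$; (3) if $\pi=\pi_1\times\pi_2$ (i.e. $\pi[x_1,x_2]=\pi_1[x_1]\pi_2[x_2]$ for all $x_1,x_2$), then $I_\infty(\pi_1\times\pi_2,C_1\times C_2)=I_\infty(\pi_1,C_1)+I_\infty(\pi_2,C_2)$.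
   Context: A (discrete) channel $(\mathcal X,\mathcal Y,C)$ consists of finite sets $\mathcal X,\mathcal Y$ and a matrix $C$ with entries $C[x,y]\ge 0$ and $\sum_{y}C[x,y]=1$ for each $x$. A prior on $\mathcal X$ is a probability distribution on $\mathcal X$. The parallel composition (with distinct inputs) $C_1\times C_2$ is the channel from $\mathcal X_1\times\mathcal X_2$ to $\mathcal Y_1\times\mathcal Y_2$ with $(C_1\times C_2)[(x_1,x_2),(y_1,y_2)]=C_1[x_1,y_1]\,C_2[x_2,y_2]$. $V(\pi)=\max_{x}\pi[x]$, $V(\pi,C)=\sum_y\max_x\pi[x]C[x,y]$, $H_\infty(\pi)=-\log V(\pi)$, $H_\infty(\pi,C)=-\log V(\pi,C)$, and the min-entropy leakage is $I_\infty(\pi,C)=H_\infty(\pi)-H_\infty(\pi,C)$. Logarithms are to base 2. The marginals of $\pi$ are $\pi_1[x_1]=\sum_{x_2}\pi[x_1,x_2]$ and $\pi_2[x_2]=\sum_{x_1}\pi[x_1,x_2]$. $\pi$ is jointly supported if for all $x_1,x_2$, $\pi_1[x_1]\pi_2[x_2]\ne 0$ implies $\pi[x_1,x_2]\neq 0$. $M^{\min}_{\infty,\pi}$ (resp. $M^{\max}_{\infty,\pi}$) is the minimum (resp. maximum) of $\frac{\pi_1[x_1]\pi_2[x_2]}{\pi[x_1,x_2]}$ over all $(x_1,x_2)$ with $\pi[x_1,x_2]\ne0$. -}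

module Defs where

open import Algebra.Bundles using (CommutativeRing)
open import Algebra.Definitions using (Congruent₁)
open import Data.Fin.Base using (Fin; zero; suc; _↑ˡ_; _↑ʳ_; combine)
open import Data.Fin.Properties using (*↔×; ¬∀⟶∃¬; remQuot-combine)
open import Data.List.Base as List using (List; filter)
import Data.List.Extrema as Extrema
open import Data.Nat.Base as ℕ using (ℕ)
open import Data.Product.Base using (_×_; _,_; ∃; proj₁; proj₂; map)
open import Data.Product.Function.NonDependent.Propositional using (_×-↔_)
open import Function.Base using (_∘_; id)
open import Function.Bundles using (_↔_; Inverse)
open import Function.Construct.Composition using (_↔-∘_)
open import Level using (_⊔_) renaming (suc to lsuc)
open import Relation.Binary.Bundles using (DecTotalOrder)
open import Relation.Binary.Core using (Rel)
import Relation.Binary.Construct.NonStrictToStrict as NonStrictToStrict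
open import Relation.Binary.PropositionalEquality.Core as ≡ using ()
open import Relation.Binary.Structures using (IsDecTotalOrder)
open import Relation.Nullary.Decidable using (¬?)
open import Relation.Unary using (Pred; Satisfiable) renaming (_∈_ to _∈ᵖ_)

-- The (classical) real numbers, given by their axioms: a Dedekind-complete
-- totally ordered field.  These axioms determine ℝ up to isomorphism.
-- Decidability of the order is the classical reading of totality;
-- the value of 0# ⁻¹ is left unspecified.
record Reals c ℓ₁ ℓ₂ : Set (lsuc (c ⊔ ℓ₁ ⊔ ℓ₂)) where
  infix  4 _≤_
  infix  8 _⁻¹
  infixl 7 _/_
  field
    commutativeRing : CommutativeRing c ℓ₁
  open CommutativeRing commutativeRing public
  field
    _≤_             : Rel Carrier ℓ₂
    isDecTotalOrder : IsDecTotalOrder _≈_ _≤_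
    _⁻¹             : Carrier → Carrier
    0≉1             : 0# ≉ 1#
    ⁻¹-cong         : Congruent₁ _≈_ _⁻¹
    ⁻¹-inverseʳ     : ∀ {x} → x ≉ 0# → x * x ⁻¹ ≈ 1#
    +-monoʳ-≤       : ∀ x {y z} → y ≤ z → x + y ≤ x + z
    *-nonNeg        : ∀ {x y} → 0# ≤ x → 0# ≤ y → 0# ≤ x * y

  UpperBound : Pred Carrier (c ⊔ ℓ₁ ⊔ ℓ₂) → Pred Carrier (c ⊔ ℓ₁ ⊔ ℓ₂)
  UpperBound S b = ∀ {x} → x ∈ᵖ S → x ≤ b

  field
    complete : ∀ S → Satisfiable S → Satisfiable (UpperBound S) →
               ∃ λ s → UpperBound S s × (∀ {b} → UpperBound S b → s ≤ b)

  decTotalOrder : DecTotalOrder c ℓ₁ ℓ₂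
  decTotalOrder = record { isDecTotalOrder = isDecTotalOrder }

  open DecTotalOrder decTotalOrder public
    using (_≟_; _≤?_; totalOrder)
    renaming (refl to ≤-refl; reflexive to ≤-reflexive; trans to ≤-trans;
              antisym to ≤-antisym; total to ≤-total)
  open NonStrictToStrict _≈_ _≤_ public using (_<_)

  _/_ : Carrier → Carrier → Carrier
  x / y = x * y ⁻¹

  -- The base-2 logarithm is the unique increasing homomorphism from
  -- (ℝ_{>0}, ·) to (ℝ, +) taking the value 1 at 2; nothing is said about
  -- its values outside ℝ_{>0}.
  record IsLog₂ (log : Carrier → Carrier) : Set (c ⊔ ℓ₁ ⊔ ℓ₂) where
    field
      log-cong   : ∀ {x y} → 0# < x → x ≈ y → log x ≈ log y
      log-mono-< : ∀ {x y} → 0# < x → x < y → log x < log y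
      log-*      : ∀ {x y} → 0# < x → 0# < y → log (x * y) ≈ log x + log y
      log-2      : log (1# + 1#) ≈ 1#

-- Nonempty because the size is a successor.  Eta is off so that X and Y can
-- be inferred from X ⊗ Y.
record FiniteSet : Set₁ where
  no-eta-equality
  field
    Element     : Set
    pred-size   : ℕ
    enumeration : Fin (ℕ.suc pred-size) ↔ Element

  size : ℕ
  size = ℕ.suc pred-size

  element : Fin size → Element
  element = Inverse.to enumeration

open FiniteSet public using (Element)

infixr 2 _⊗_

_⊗_ : FiniteSet → FiniteSet → FiniteSet
(X ⊗ Y) .FiniteSet.Element     = Element X × Element Y
(X ⊗ Y) .FiniteSet.pred-size   =
  FiniteSet.pred-size Y ℕ.+ FiniteSet.pred-size X ℕ.* FiniteSet.size Y
(X ⊗ Y) .FiniteSet.enumeration =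
  (FiniteSet.enumeration X ×-↔ FiniteSet.enumeration Y) ↔-∘ *↔×

module Leakage {c ℓ₁ ℓ₂} (ℝ : Reals c ℓ₁ ℓ₂)
               (log : Reals.Carrier ℝ → Reals.Carrier ℝ) where

  open Reals ℝ hiding (zero)
  open import Algebra.Properties.Semiring.Sum semiring
    using (sum; sum-cong-≋; sum-replicate-zero; ∑-comm;
           *-distribˡ-sum)
  open import Relation.Binary.Reasoning.Setoid setoid

  private
    variable
      X Y X₁ X₂ Y₁ Y₂ : FiniteSet

  ∑ : (X : FiniteSet) → (Element X → Carrier) → Carrier
  ∑ X f = sum (f ∘ FiniteSet.element X)

  maximum : (X : FiniteSet) → (Element X → Carrier) → Carrier
  maximum X f =
    Extrema.max totalOrder (f (element zero)) (List.tabulate (f ∘ element ∘ suc))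
    where open FiniteSet X using (element)

  ∑-cong : ∀ X {f g : Element X → Carrier} → (∀ x → f x ≈ g x) → ∑ X f ≈ ∑ X g
  ∑-cong X f≈g = sum-cong-≋ (f≈g ∘ FiniteSet.element X)

  private
    sum-++ : ∀ m {n} (f : Fin (m ℕ.+ n) → Carrier) →
             sum f ≈ sum (λ i → f (i ↑ˡ n)) + sum (λ j → f (m ↑ʳ j))
    sum-++ ℕ.zero    f = sym (+-identityˡ _)
    sum-++ (ℕ.suc m) f = trans (+-congˡ (sum-++ m (f ∘ suc))) (sym (+-assoc _ _ _))

    sum-combine : ∀ m {n} (f : Fin (m ℕ.* n) → Carrier) →
                  sum f ≈ sum {m} (λ i → sum {n} (λ j → f (combine i j)))
    sum-combine ℕ.zero        f = refl
    sum-combine (ℕ.suc m) {n} f =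
      trans (sum-++ n f) (+-congˡ (sum-combine m (f ∘ (n ↑ʳ_))))

  ∑-⊗ : ∀ X Y (f : Element (X ⊗ Y) → Carrier) →
        ∑ (X ⊗ Y) f ≈ ∑ X (λ x → ∑ Y (λ y → f (x , y)))
  ∑-⊗ X Y f = trans (sum-combine X.size (f ∘ FiniteSet.element (X ⊗ Y)))
    (sum-cong-≋ λ i → sum-cong-≋ λ j →
      reflexive (≡.cong (f ∘ map X.element Y.element)
                        (remQuot-combine {X.size} {Y.size} i j)))
    where
    module X = FiniteSet X
    module Y = FiniteSet Y

  ∑-* : ∀ X Y (f : Element X → Carrier) (g : Element Y → Carrier) →
        ∑ X f ≈ 1# → ∑ Y g ≈ 1# →
        ∑ (X ⊗ Y) (λ p → f (proj₁ p) * g (proj₂ p)) ≈ 1#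
  ∑-* X Y f g ∑f ∑g = begin
    ∑ (X ⊗ Y) fg                 ≈⟨ ∑-⊗ X Y fg ⟩
    ∑ X (λ x → ∑ Y (λ y → f x * g y))
      ≈⟨ ∑-cong X {g = λ x → f x * ∑ Y g}
           (λ x → sym (*-distribˡ-sum {Y.size} (f x) (g ∘ Y.element))) ⟩
    ∑ X (λ x → f x * ∑ Y g)
      ≈⟨ ∑-cong X {g = f} (λ x → trans (*-congˡ ∑g) (*-identityʳ (f x))) ⟩
    ∑ X f                        ≈⟨ ∑f ⟩
    1#                           ∎
    where
    module Y = FiniteSet Y
    fg : Element (X ⊗ Y) → Carrier
    fg (x , y) = f x * g y

  ∑-nonNeg : ∀ X {f : Element X → Carrier} → (∀ x → 0# ≤ f x) → 0# ≤ ∑ X f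
  ∑-nonNeg X 0≤f = go (0≤f ∘ FiniteSet.element X)
    where
    +-nonNeg : ∀ {x y} → 0# ≤ x → 0# ≤ y → 0# ≤ x + y
    +-nonNeg {x} 0≤x 0≤y =
      ≤-trans 0≤x (≤-trans (≤-reflexive (sym (+-identityʳ x))) (+-monoʳ-≤ x 0≤y))
    go : ∀ {n} {f : Fin n → Carrier} → (∀ i → 0# ≤ f i) → 0# ≤ sum f
    go {ℕ.zero}  _   = ≤-refl
    go {ℕ.suc n} 0≤f = +-nonNeg (0≤f zero) (go (0≤f ∘ suc))

  record Prior (X : FiniteSet) : Set (c ⊔ ℓ₁ ⊔ ℓ₂) where
    field
      prob        : Element X → Carrier
      prob-nonNeg : ∀ x → 0# ≤ prob x
      prob-sum    : ∑ X prob ≈ 1#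

  open Prior public

  record Channel (X Y : FiniteSet) : Set (c ⊔ ℓ₁ ⊔ ℓ₂) where
    field
      entry        : Element X → Element Y → Carrier
      entry-nonNeg : ∀ x y → 0# ≤ entry x y
      entry-sum    : ∀ x → ∑ Y (entry x) ≈ 1#

  open Channel public

  infixr 7 _×ᶜ_ _×ᵖ_

  _×ᶜ_ : Channel X₁ Y₁ → Channel X₂ Y₂ → Channel (X₁ ⊗ X₂) (Y₁ ⊗ Y₂)
  _×ᶜ_ {Y₁ = Y₁} {Y₂ = Y₂} C₁ C₂ = record
    { entry        = λ (x₁ , x₂) (y₁ , y₂) → entry C₁ x₁ y₁ * entry C₂ x₂ y₂
    ; entry-nonNeg = λ (x₁ , x₂) (y₁ , y₂) →
        *-nonNeg (entry-nonNeg C₁ x₁ y₁) (entry-nonNeg C₂ x₂ y₂)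
    ; entry-sum    = λ (x₁ , x₂) →
        ∑-* Y₁ Y₂ (entry C₁ x₁) (entry C₂ x₂) (entry-sum C₁ x₁) (entry-sum C₂ x₂)
    }

  _×ᵖ_ : Prior X₁ → Prior X₂ → Prior (X₁ ⊗ X₂)
  _×ᵖ_ {X₁} {X₂} π₁ π₂ = record
    { prob        = λ (x₁ , x₂) → prob π₁ x₁ * prob π₂ x₂
    ; prob-nonNeg = λ (x₁ , x₂) → *-nonNeg (prob-nonNeg π₁ x₁) (prob-nonNeg π₂ x₂)
    ; prob-sum    = ∑-* X₁ X₂ (prob π₁) (prob π₂) (prob-sum π₁) (prob-sum π₂)
    }

  marginal₁ : Prior (X₁ ⊗ X₂) → Prior X₁
  marginal₁ {X₁} {X₂} π = record
    { prob        = λ x₁ → ∑ X₂ (λ x₂ → prob π (x₁ , x₂))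
    ; prob-nonNeg = λ x₁ → ∑-nonNeg X₂ (λ x₂ → prob-nonNeg π (x₁ , x₂))
    ; prob-sum    = trans (sym (∑-⊗ X₁ X₂ (prob π))) (prob-sum π)
    }

  marginal₂ : Prior (X₁ ⊗ X₂) → Prior X₂
  marginal₂ {X₁} {X₂} π = record
    { prob        = λ x₂ → ∑ X₁ (λ x₁ → prob π (x₁ , x₂))
    ; prob-nonNeg = λ x₂ → ∑-nonNeg X₁ (λ x₁ → prob-nonNeg π (x₁ , x₂))
    ; prob-sum    = trans (sym (trans (∑-⊗ X₁ X₂ (prob π)) ∑-swap)) (prob-sum π)
    }
    where
    ∑-swap : ∑ X₁ (λ x₁ → ∑ X₂ (λ x₂ → prob π (x₁ , x₂))) ≈
             ∑ X₂ (λ x₂ → ∑ X₁ (λ x₁ → prob π (x₁ , x₂)))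
    ∑-swap = ∑-comm {FiniteSet.size X₁} {FiniteSet.size X₂}
      (λ i j → prob π (FiniteSet.element X₁ i , FiniteSet.element X₂ j))

  priorV : Prior X → Carrier
  priorV {X} π = maximum X (prob π)

  posteriorV : Prior X → Channel X Y → Carrier
  posteriorV {X} {Y} π C = ∑ Y λ y → maximum X λ x → prob π x * entry C x y

  priorH∞ : Prior X → Carrier
  priorH∞ π = - log (priorV π)

  posteriorH∞ : Prior X → Channel X Y → Carrier
  posteriorH∞ π C = - log (posteriorV π C)

  I∞ : Prior X → Channel X Y → Carrier
  I∞ π C = priorH∞ π - posteriorH∞ π C

  Support : Prior X → Pred (Element X) ℓ₁
  Support π x = prob π x ≉ 0#

  JointlySupported : Prior (X₁ ⊗ X₂) → Set ℓ₁
  JointlySupported π =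
    ∀ x₁ x₂ → prob (marginal₁ π) x₁ * prob (marginal₂ π) x₂ ≉ 0# →
    prob π (x₁ , x₂) ≉ 0#

  supportList : Prior X → List (Element X)
  supportList {X} π =
    filter (λ x → ¬? (prob π x ≟ 0#)) (List.tabulate (FiniteSet.element X))

  support-nonEmpty : (π : Prior X) → Satisfiable (Support π)
  support-nonEmpty {X} π =
    map X.element id (¬∀⟶∃¬ X.size _ (λ i → prob π (X.element i) ≟ 0#) λ all≈0 →
      0≉1 (trans (sym (sum-replicate-zero X.size))
                 (trans (sym (sum-cong-≋ all≈0)) (prob-sum π))))
    where module X = FiniteSet X

  ratio : Prior (X₁ ⊗ X₂) → Element (X₁ ⊗ X₂) → Carrier
  ratio π (x₁ , x₂) = (prob (marginal₁ π) x₁ * prob (marginal₂ π) x₂) / prob π (x₁ , x₂)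

  -- The extremum over the support is that of a list, seeded with a value
  -- which is itself attained on the support.
  M-min M-max : Prior (X₁ ⊗ X₂) → Carrier
  M-min π = Extrema.min totalOrder (ratio π (proj₁ (support-nonEmpty π)))
                                   (List.map (ratio π) (supportList π))
  M-max π = Extrema.max totalOrder (ratio π (proj₁ (support-nonEmpty π)))
                                   (List.map (ratio π) (supportList π))

{-# OPTIONS --safe #-}

-- For two priors with ρ ≤ K π and π ≤ L ρ pointwise, the vulnerabilities obey
-- V(ρ, C) ≤ K V(π, C) and V(π) ≤ L V(ρ), so that
-- I∞(ρ, C) ≤ I∞(π, C) + log (K L).  Leakage is additive on product priors,
-- because both the maximum and the sum of a product of nonnegative functions
-- of independent variables factor.  On the support of π the definition of
-- M-min and M-max reads M-min · π ≤ π₁ × π₂ ≤ M-max · π, and off the support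
-- joint support makes all three sides vanish; so comparing π with π₁ × π₂ in
-- the two directions, with {K, L} = {M-max, M-min⁻¹}, yields the two bounds.
module Submission where

import Algebra.Properties.AbelianGroup as AbelianGroupProperties
import Algebra.Properties.CommutativeSemigroup as CommutativeSemigroupProperties
import Algebra.Properties.Ring as RingProperties
import Algebra.Properties.Semiring.Sum as SemiringSum
open import Data.Fin.Base using (Fin; zero; suc)
import Data.List.Extrema as Extrema
import Data.List.Base as List
open import Data.List.Membership.Propositional using (_∈_)
import Data.List.Membership.Propositional.Properties as Membership
import Data.List.Relation.Unary.All as All
import Data.List.Relation.Unary.All.Properties as All
import Data.Nat.Base as ℕ
open import Data.Product.Base using (_×_; _,_; ∃; proj₁; proj₂)
open import Data.Sum.Base using (inj₁; inj₂)
open import Function.Base using (id; _∘_)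
open import Function.Bundles using (Inverse)
open import Relation.Binary.Bundles using (DecTotalOrder)
import Relation.Binary.Reasoning.PartialOrder as PartialOrderReasoning
open import Relation.Binary.PropositionalEquality.Core as ≡ using (_≡_)
open import Relation.Nullary using (yes; no; ¬?)
open import Relation.Nullary.Negation using (contradiction)

open import Defs

-- Arithmetic of a totally ordered field.

module RealsProperties {c ℓ₁ ℓ₂} (ℝ : Reals c ℓ₁ ℓ₂) where

  open Reals ℝ hiding (zero)
  open RingProperties ring
    using (-‿involutive; -‿distribˡ-*; -‿distribʳ-*)
  open AbelianGroupProperties +-abelianGroup using (xyx⁻¹≈y)
  open PartialOrderReasoning (DecTotalOrder.poset decTotalOrder)

  +-monoˡ-≤ : ∀ x {y z} → y ≤ z → y + x ≤ z + x
  +-monoˡ-≤ x {y} {z} y≤z = begin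
    y + x  ≈⟨ +-comm y x ⟩
    x + y  ≤⟨ +-monoʳ-≤ x y≤z ⟩
    x + z  ≈⟨ +-comm x z ⟩
    z + x  ∎

  +-mono-≤ : ∀ {x y u v} → x ≤ y → u ≤ v → x + u ≤ y + v
  +-mono-≤ {y = y} {u} x≤y u≤v = ≤-trans (+-monoˡ-≤ u x≤y) (+-monoʳ-≤ y u≤v)

  x≤y+z⇒x-z≤y : ∀ {x y z} → x ≤ y + z → x - z ≤ y
  x≤y+z⇒x-z≤y {x} {y} {z} x≤y+z = begin
    x - z          ≤⟨ +-monoˡ-≤ (- z) x≤y+z ⟩
    (y + z) - z    ≈⟨ +-assoc y z (- z) ⟩
    y + (z - z)    ≈⟨ +-congˡ (-‿inverseʳ z) ⟩
    y + 0#         ≈⟨ +-identityʳ y ⟩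
    y              ∎

  -- With `z` the log prior vulnerability of one prior and `x` that of another, this turns an upper
  -- bound on `x` into the upper bound on `- z` that enters a leakage.
  x≤y+z⇒-z≤y-x : ∀ {x y z} → x ≤ y + z → - z ≤ y - x
  x≤y+z⇒-z≤y-x {x} {y} {z} x≤y+z = begin
    - z            ≈⟨ xyx⁻¹≈y x (- z) ⟨
    (x - z) - x    ≤⟨ +-monoˡ-≤ (- x) (x≤y+z⇒x-z≤y x≤y+z) ⟩
    y - x          ∎

  x≤y⇒0≤y-x : ∀ {x y} → x ≤ y → 0# ≤ y - x
  x≤y⇒0≤y-x {x} {y} x≤y = begin
    0#     ≈⟨ -‿inverseʳ x ⟨
    x - x  ≤⟨ +-monoˡ-≤ (- x) x≤y ⟩
    y - x  ∎

  -- `x * z` is `x * y` plus the product `x * (z - y)` of nonnegative factors.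
  *-monoʳ-≤ : ∀ {x y z} → 0# ≤ x → y ≤ z → x * y ≤ x * z
  *-monoʳ-≤ {x} {y} {z} 0≤x y≤z = begin
    x * y                    ≈⟨ +-identityʳ (x * y) ⟨
    x * y + 0#               ≤⟨ +-monoʳ-≤ (x * y) (*-nonNeg 0≤x (x≤y⇒0≤y-x y≤z)) ⟩
    x * y + x * (z - y)      ≈⟨ distribˡ x y (z - y) ⟨
    x * (y + (z - y))        ≈⟨ *-congˡ (+-assoc y z (- y)) ⟨
    x * ((y + z) - y)        ≈⟨ *-congˡ (xyx⁻¹≈y y z) ⟩
    x * z                    ∎

  *-monoˡ-≤ : ∀ {x y z} → 0# ≤ x → y ≤ z → y * x ≤ z * x
  *-monoˡ-≤ {x} {y} {z} 0≤x y≤z = begin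
    y * x  ≈⟨ *-comm y x ⟩
    x * y  ≤⟨ *-monoʳ-≤ 0≤x y≤z ⟩
    x * z  ≈⟨ *-comm x z ⟩
    z * x  ∎

  *-mono-≤ : ∀ {x y u v} → 0# ≤ u → 0# ≤ y → x ≤ y → u ≤ v → x * u ≤ y * v
  *-mono-≤ 0≤u 0≤y x≤y u≤v = ≤-trans (*-monoˡ-≤ 0≤u x≤y) (*-monoʳ-≤ 0≤y u≤v)

  0≤x*x : ∀ x → 0# ≤ x * x
  0≤x*x x with ≤-total 0# x
  ... | inj₁ 0≤x = *-nonNeg 0≤x 0≤x
  ... | inj₂ x≤0 = begin
    0#             ≤⟨ *-nonNeg 0≤-x 0≤-x ⟩
    - x * - x      ≈⟨ -‿distribˡ-* x (- x) ⟨
    - (x * - x)    ≈⟨ -‿cong (-‿distribʳ-* x x) ⟨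
    - - (x * x)    ≈⟨ -‿involutive (x * x) ⟩
    x * x          ∎
    where
    0≤-x : 0# ≤ - x
    0≤-x = ≤-trans (x≤y⇒0≤y-x x≤0) (≤-reflexive (+-identityˡ (- x)))

  <⇒≉0 : ∀ {x} → 0# < x → x ≉ 0#
  <⇒≉0 (_ , 0≉x) x≈0 = 0≉x (sym x≈0)

  <-≤-trans : ∀ {x y z} → x < y → y ≤ z → x < z
  <-≤-trans {x} {y} {z} x<y y≤z = begin-strict
    x  <⟨ x<y ⟩
    y  ≤⟨ y≤z ⟩
    z  ∎

  x*[x⁻¹*y]≈y : ∀ {x} → x ≉ 0# → ∀ y → x * (x ⁻¹ * y) ≈ y
  x*[x⁻¹*y]≈y {x} x≉0 y = begin-equality
    x * (x ⁻¹ * y)  ≈⟨ *-assoc x (x ⁻¹) y ⟨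
    x * x ⁻¹ * y    ≈⟨ *-congʳ (⁻¹-inverseʳ x≉0) ⟩
    1# * y          ≈⟨ *-identityˡ y ⟩
    y               ∎

  x⁻¹*[x*y]≈y : ∀ {x} → x ≉ 0# → ∀ y → x ⁻¹ * (x * y) ≈ y
  x⁻¹*[x*y]≈y {x} x≉0 y = begin-equality
    x ⁻¹ * (x * y)  ≈⟨ *-assoc (x ⁻¹) x y ⟨
    x ⁻¹ * x * y    ≈⟨ *-congʳ (*-comm (x ⁻¹) x) ⟩
    x * x ⁻¹ * y    ≈⟨ *-assoc x (x ⁻¹) y ⟩
    x * (x ⁻¹ * y)  ≈⟨ x*[x⁻¹*y]≈y x≉0 y ⟩
    y               ∎

  y/x*x≈y : ∀ {x} → x ≉ 0# → ∀ y → y / x * x ≈ y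
  y/x*x≈y {x} x≉0 y = begin-equality
    y * x ⁻¹ * x    ≈⟨ *-comm (y * x ⁻¹) x ⟩
    x * (y * x ⁻¹)  ≈⟨ *-congˡ (*-comm y (x ⁻¹)) ⟩
    x * (x ⁻¹ * y)  ≈⟨ x*[x⁻¹*y]≈y x≉0 y ⟩
    y               ∎

  -- Strictness is the absence of zero divisors: if `x * y` vanished, multiplying by `x ⁻¹` would
  -- make `y` vanish.
  *-pos : ∀ {x y} → 0# < x → 0# < y → 0# < x * y
  *-pos {x} {y} 0<x 0<y = *-nonNeg (proj₁ 0<x) (proj₁ 0<y) , λ 0≈xy →
    <⇒≉0 0<y (begin-equality
      y               ≈⟨ x⁻¹*[x*y]≈y (<⇒≉0 0<x) y ⟨
      x ⁻¹ * (x * y)  ≈⟨ *-congˡ 0≈xy ⟨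
      x ⁻¹ * 0#       ≈⟨ zeroʳ (x ⁻¹) ⟩
      0#              ∎)

  -- The axioms relate inverse and order only through products: `x ⁻¹` equals `x` times the square
  -- of `x ⁻¹`, hence is nonnegative, and it is nonzero because `x * x ⁻¹` is one.
  ⁻¹-pos : ∀ {x} → 0# < x → 0# < x ⁻¹
  ⁻¹-pos {x} 0<x = 0≤x⁻¹ , λ 0≈x⁻¹ → 0≉1 (begin-equality
      0#        ≈⟨ zeroʳ x ⟨
      x * 0#    ≈⟨ *-congˡ 0≈x⁻¹ ⟩
      x * x ⁻¹  ≈⟨ ⁻¹-inverseʳ (<⇒≉0 0<x) ⟩
      1#        ∎)
    where
    0≤x⁻¹ : 0# ≤ x ⁻¹
    0≤x⁻¹ = begin
      0#                 ≤⟨ *-nonNeg (proj₁ 0<x) (0≤x*x (x ⁻¹)) ⟩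
      x * (x ⁻¹ * x ⁻¹)  ≈⟨ x*[x⁻¹*y]≈y (<⇒≉0 0<x) (x ⁻¹) ⟩
      x ⁻¹               ∎

  -- Logarithms of positive reals.

  module _ {log : Carrier → Carrier} (isLog₂ : IsLog₂ log) where

    open IsLog₂ isLog₂

    log-mono-≤ : ∀ {x y} → 0# < x → x ≤ y → log x ≤ log y
    log-mono-≤ {x} {y} 0<x x≤y with x ≟ y
    ... | yes x≈y = ≤-reflexive (log-cong 0<x x≈y)
    ... | no  x≉y = proj₁ (log-mono-< 0<x (x≤y , x≉y))

    log-≤-* : ∀ {x k y} → 0# < x → 0# < k → 0# < y → x ≤ k * y →
              log x ≤ log k + log y
    log-≤-* 0<x 0<k 0<y x≤ky =
      ≤-trans (log-mono-≤ 0<x x≤ky) (≤-reflexive (log-* 0<k 0<y))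

module LeakageProperties {c ℓ₁ ℓ₂} (ℝ : Reals c ℓ₁ ℓ₂)
                         (log : Reals.Carrier ℝ → Reals.Carrier ℝ) where

  open Reals ℝ hiding (zero)
  open RealsProperties ℝ
  open Leakage ℝ log
  open AbelianGroupProperties +-abelianGroup
    using (⁻¹-∙-comm; ⁻¹-involutive)
  module + = CommutativeSemigroupProperties +-commutativeSemigroup
  module * = CommutativeSemigroupProperties *-commutativeSemigroup
  open SemiringSum semiring
    using (sum; sum-replicate-zero; *-distribˡ-sum; *-distribʳ-sum)
  open PartialOrderReasoning (DecTotalOrder.poset decTotalOrder)

  private
    variable
      X Y X₁ X₂ Y₁ Y₂ : FiniteSet

  -- Finite sums.

  sum-mono : ∀ {n} {f g : Fin n → Carrier} → (∀ i → f i ≤ g i) → sum f ≤ sum g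
  sum-mono {ℕ.zero}  f≤g = ≤-refl
  sum-mono {ℕ.suc n} f≤g = +-mono-≤ (f≤g zero) (sum-mono (f≤g ∘ suc))

  ∑-mono : ∀ X {f g : Element X → Carrier} → (∀ x → f x ≤ g x) → ∑ X f ≤ ∑ X g
  ∑-mono X f≤g = sum-mono (f≤g ∘ FiniteSet.element X)

  *-distribˡ-∑ : ∀ X k (f : Element X → Carrier) → k * ∑ X f ≈ ∑ X (λ x → k * f x)
  *-distribˡ-∑ X k f = *-distribˡ-sum {FiniteSet.size X} k (f ∘ FiniteSet.element X)

  *-distribʳ-∑ : ∀ X k (f : Element X → Carrier) → ∑ X f * k ≈ ∑ X (λ x → f x * k)
  *-distribʳ-∑ X k f = *-distribʳ-sum {FiniteSet.size X} k (f ∘ FiniteSet.element X)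

  ∑-⊗-* : ∀ X Y (f : Element X → Carrier) (g : Element Y → Carrier) →
          ∑ (X ⊗ Y) (λ (x , y) → f x * g y) ≈ ∑ X f * ∑ Y g
  ∑-⊗-* X Y f g = begin-equality
    ∑ (X ⊗ Y) (λ (x , y) → f x * g y)    ≈⟨ ∑-⊗ X Y (λ (x , y) → f x * g y) ⟩
    ∑ X (λ x → ∑ Y (λ y → f x * g y))    ≈⟨ ∑-cong X (λ x → *-distribˡ-∑ Y (f x) g) ⟨
    ∑ X (λ x → f x * ∑ Y g)              ≈⟨ *-distribʳ-∑ X (∑ Y g) f ⟨
    ∑ X f * ∑ Y g                        ∎

  -- Sums and maxima run over indices; surjectivity of the enumeration carries what is proved for
  -- indices over to all elements.
  elementwise : ∀ X {p} {P : Element X → Set p} →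
                (∀ i → P (FiniteSet.element X i)) → ∀ x → P x
  elementwise X {P = P} Pelement x =
    ≡.subst P (Inverse.strictlyInverseˡ enumeration x) (Pelement (Inverse.from enumeration x))
    where open FiniteSet X using (enumeration)

  ≤-sum : ∀ {n} {f : Fin n → Carrier} → (∀ i → 0# ≤ f i) → ∀ i → f i ≤ sum f
  ≤-sum {ℕ.suc n} {f} 0≤f zero = begin
    f zero                        ≈⟨ +-identityʳ (f zero) ⟨
    f zero + 0#                   ≈⟨ +-congˡ (sum-replicate-zero n) ⟨
    f zero + sum {n} (λ _ → 0#)   ≤⟨ +-monoʳ-≤ (f zero) (sum-mono (0≤f ∘ suc)) ⟩
    f zero + sum (f ∘ suc)        ∎
  ≤-sum {ℕ.suc n} {f} 0≤f (suc i) = begin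
    f (suc i)                     ≤⟨ ≤-sum (0≤f ∘ suc) i ⟩
    sum (f ∘ suc)                 ≈⟨ +-identityˡ (sum (f ∘ suc)) ⟨
    0# + sum (f ∘ suc)            ≤⟨ +-monoˡ-≤ (sum (f ∘ suc)) (0≤f zero) ⟩
    f zero + sum (f ∘ suc)        ∎

  ≤-∑ : ∀ X {f : Element X → Carrier} → (∀ x → 0# ≤ f x) → ∀ x → f x ≤ ∑ X f
  ≤-∑ X {f} 0≤f = elementwise X (≤-sum (0≤f ∘ FiniteSet.element X))

  -- Maxima over finite sets.

  ≤-maximum : ∀ X (f : Element X → Carrier) x → f x ≤ maximum X f
  ≤-maximum X f = elementwise X λ where
      -- Index zero is the seed of the maximum, and the list holds only the later indices.
      zero    → Extrema.⊥≤max totalOrder (f (element zero)) fs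
      (suc i) → All.tabulate⁻ (Extrema.xs≤max totalOrder (f (element zero)) fs) i
    where
    open FiniteSet X using (element)
    fs = List.tabulate (f ∘ element ∘ suc)

  -- Being a value of `f` is a property of the seed and of every list entry, and the maximum is one
  -- of these.
  maximum-attained : ∀ X (f : Element X → Carrier) → ∃ λ x → maximum X f ≡ f x
  maximum-attained X f = Extrema.argmax-all totalOrder id
      {P = λ v → ∃ λ x → v ≡ f x}
      (element zero , ≡.refl) (All.tabulate⁺ λ i → element (suc i) , ≡.refl)
    where open FiniteSet X using (element)

  maximum-≤ : ∀ X {f : Element X → Carrier} {b} → (∀ x → f x ≤ b) → maximum X f ≤ b
  maximum-≤ X {f} f≤b with maximum-attained X f
  ... | x , max≡fx = ≤-trans (≤-reflexive (reflexive max≡fx)) (f≤b x)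

  maximum-cong : ∀ X {f g : Element X → Carrier} → (∀ x → f x ≈ g x) →
                 maximum X f ≈ maximum X g
  maximum-cong X {f} {g} f≈g = ≤-antisym
    (maximum-≤ X λ x → ≤-trans (≤-reflexive (f≈g x)) (≤-maximum X g x))
    (maximum-≤ X λ x → ≤-trans (≤-reflexive (sym (f≈g x))) (≤-maximum X f x))

  maximum-≤-* : ∀ X {f g : Element X → Carrier} {k} → 0# ≤ k →
                (∀ x → f x ≤ k * g x) → maximum X f ≤ k * maximum X g
  maximum-≤-* X {g = g} 0≤k f≤kg =
    maximum-≤ X λ x → ≤-trans (f≤kg x) (*-monoʳ-≤ 0≤k (≤-maximum X g x))

  -- Nonnegativity lets the two pointwise bounds be multiplied, which gives the upper half. For the
  -- lower half, maximisers of the two factors form a point of the product.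
  maximum-⊗-* : ∀ X Y {f : Element X → Carrier} {g : Element Y → Carrier} →
                (∀ x → 0# ≤ f x) → (∀ y → 0# ≤ g y) →
                maximum (X ⊗ Y) (λ (x , y) → f x * g y) ≈ maximum X f * maximum Y g
  maximum-⊗-* X Y {f} {g} 0≤f 0≤g = ≤-antisym upper lower
    where
    fg : Element (X ⊗ Y) → Carrier
    fg (x , y) = f x * g y

    upper : maximum (X ⊗ Y) fg ≤ maximum X f * maximum Y g
    upper = maximum-≤ (X ⊗ Y) λ (x , y) →
      *-mono-≤ (0≤g y) (≤-trans (0≤f x) (≤-maximum X f x))
               (≤-maximum X f x) (≤-maximum Y g y)

    lower : maximum X f * maximum Y g ≤ maximum (X ⊗ Y) fg
    lower with maximum-attained X f | maximum-attained Y g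
    ... | x , maxf≡fx | y , maxg≡gy = begin
      maximum X f * maximum Y g  ≈⟨ *-cong (reflexive maxf≡fx) (reflexive maxg≡gy) ⟩
      f x * g y                  ≤⟨ ≤-maximum (X ⊗ Y) fg (x , y) ⟩
      maximum (X ⊗ Y) fg         ∎

  -- Prior and posterior vulnerability.

  support-pos : (π : Prior X) → ∀ {x} → Support π x → 0# < prob π x
  support-pos π {x} πx≉0 = prob-nonNeg π x , πx≉0 ∘ sym

  -- The laws of `IsLog₂` hold only at positive arguments, so vulnerabilities must be positive
  -- before their logarithms are compared. Any point of the support is a witness.
  priorV-pos : (π : Prior X) → 0# < priorV π
  priorV-pos {X} π with support-nonEmpty π
  ... | x , πx≉0 = <-≤-trans (support-pos π πx≉0) (≤-maximum X (prob π) x)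

  -- Guessing the fixed `x` whatever the output succeeds with probability `prob π x`, as row `x` of
  -- `C` sums to one; the best guess for each output does at least as well.
  prob≤posteriorV : (π : Prior X) (C : Channel X Y) → ∀ x → prob π x ≤ posteriorV π C
  prob≤posteriorV {X} {Y} π C x = begin
    prob π x                           ≈⟨ *-identityʳ (prob π x) ⟨
    prob π x * 1#                      ≈⟨ *-congˡ (entry-sum C x) ⟨
    prob π x * ∑ Y (entry C x)         ≈⟨ *-distribˡ-∑ Y (prob π x) (entry C x) ⟩
    ∑ Y (λ y → prob π x * entry C x y)
      ≤⟨ ∑-mono Y (λ y → ≤-maximum X (λ x → prob π x * entry C x y) x) ⟩
    posteriorV π C                     ∎

  posteriorV-pos : (π : Prior X) (C : Channel X Y) → 0# < posteriorV π C
  posteriorV-pos π C with support-nonEmpty π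
  ... | x , πx≉0 = <-≤-trans (support-pos π πx≉0) (prob≤posteriorV π C x)

  priorV-≤-* : (π ρ : Prior X) → ∀ {k} → 0# ≤ k →
               (∀ x → prob ρ x ≤ k * prob π x) → priorV ρ ≤ k * priorV π
  priorV-≤-* {X} π ρ = maximum-≤-* X

  posteriorV-≤-* : (π ρ : Prior X) (C : Channel X Y) → ∀ {k} → 0# ≤ k →
                   (∀ x → prob ρ x ≤ k * prob π x) →
                   posteriorV ρ C ≤ k * posteriorV π C
  posteriorV-≤-* {X} {Y} π ρ C {k} 0≤k ρ≤kπ = begin
    posteriorV ρ C
      ≤⟨ ∑-mono Y (λ y → maximum-≤-* X 0≤k λ x →
           ≤-trans (*-monoˡ-≤ (entry-nonNeg C x y) (ρ≤kπ x))
                   (≤-reflexive (*-assoc k (prob π x) (entry C x y)))) ⟩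
    ∑ Y (λ y → k * maximum X λ x → prob π x * entry C x y)
      ≈⟨ *-distribˡ-∑ Y k (λ y → maximum X λ x → prob π x * entry C x y) ⟨
    k * posteriorV π C  ∎

  priorV-×ᵖ : (π₁ : Prior X₁) (π₂ : Prior X₂) →
              priorV (π₁ ×ᵖ π₂) ≈ priorV π₁ * priorV π₂
  priorV-×ᵖ {X₁} {X₂} π₁ π₂ = maximum-⊗-* X₁ X₂ (prob-nonNeg π₁) (prob-nonNeg π₂)

  -- For fixed outputs the joint weight regroups into a factor in `x₁` and a factor in `x₂`, so the
  -- maximum splits; this leaves a function of `y₁` times a function of `y₂`, so the sum splits as
  -- well.
  posteriorV-×ᵖ : (π₁ : Prior X₁) (π₂ : Prior X₂)
                  (C₁ : Channel X₁ Y₁) (C₂ : Channel X₂ Y₂) →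
                  posteriorV (π₁ ×ᵖ π₂) (C₁ ×ᶜ C₂) ≈
                  posteriorV π₁ C₁ * posteriorV π₂ C₂
  posteriorV-×ᵖ {X₁} {X₂} {Y₁} {Y₂} π₁ π₂ C₁ C₂ = begin-equality
    posteriorV (π₁ ×ᵖ π₂) (C₁ ×ᶜ C₂)
      ≈⟨ ∑-cong (Y₁ ⊗ Y₂) (λ (y₁ , y₂) → trans
           (maximum-cong (X₁ ⊗ X₂) λ (x₁ , x₂) →
             *.interchange (prob π₁ x₁) (prob π₂ x₂) (entry C₁ x₁ y₁) (entry C₂ x₂ y₂))
           (maximum-⊗-* X₁ X₂
             (λ x₁ → *-nonNeg (prob-nonNeg π₁ x₁) (entry-nonNeg C₁ x₁ y₁))
             (λ x₂ → *-nonNeg (prob-nonNeg π₂ x₂) (entry-nonNeg C₂ x₂ y₂)))) ⟩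
    ∑ (Y₁ ⊗ Y₂) (λ (y₁ , y₂) → joint₁ y₁ * joint₂ y₂)
      ≈⟨ ∑-⊗-* Y₁ Y₂ joint₁ joint₂ ⟩
    posteriorV π₁ C₁ * posteriorV π₂ C₂  ∎
    where
    joint₁ : Element Y₁ → Carrier
    joint₁ y₁ = maximum X₁ λ x₁ → prob π₁ x₁ * entry C₁ x₁ y₁
    joint₂ : Element Y₂ → Carrier
    joint₂ y₂ = maximum X₂ λ x₂ → prob π₂ x₂ * entry C₂ x₂ y₂

  -- Min-entropy leakage.

  I∞≈log-log : (π : Prior X) (C : Channel X Y) →
               I∞ π C ≈ log (posteriorV π C) - log (priorV π)
  I∞≈log-log π C = begin-equality
    - log (priorV π) - - log (posteriorV π C)  ≈⟨ +-congˡ (⁻¹-involutive _) ⟩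
    - log (priorV π) + log (posteriorV π C)    ≈⟨ +-comm _ _ ⟩
    log (posteriorV π C) - log (priorV π)      ∎

  module _ (isLog₂ : IsLog₂ log) where

    open IsLog₂ isLog₂

    -- Leakage grows with the posterior vulnerability and falls with the prior one, hence a
    -- comparison in each direction: `k` bounds the posterior vulnerability of `ρ` from above, `l`
    -- its prior vulnerability from below.
    I∞-≤ : (π ρ : Prior X) (C : Channel X Y) → ∀ {k l} → 0# < k → 0# < l →
           (∀ x → prob ρ x ≤ k * prob π x) → (∀ x → prob π x ≤ l * prob ρ x) →
           I∞ ρ C ≤ I∞ π C + log (k * l)
    I∞-≤ π ρ C {k} {l} 0<k 0<l ρ≤kπ π≤lρ = begin
      I∞ ρ C
        ≈⟨ I∞≈log-log ρ C ⟩
      log (posteriorV ρ C) - log (priorV ρ)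
        ≤⟨ +-mono-≤
             (log-≤-* isLog₂ (posteriorV-pos ρ C) 0<k (posteriorV-pos π C)
               (posteriorV-≤-* π ρ C (proj₁ 0<k) ρ≤kπ))
             (x≤y+z⇒-z≤y-x
               (log-≤-* isLog₂ (priorV-pos π) 0<l (priorV-pos ρ)
                 (priorV-≤-* ρ π (proj₁ 0<l) π≤lρ))) ⟩
      (log k + log (posteriorV π C)) + (log l - log (priorV π))
        ≈⟨ +.interchange _ _ _ _ ⟩
      (log k + log l) + (log (posteriorV π C) - log (priorV π))
        ≈⟨ +-comm _ _ ⟩
      (log (posteriorV π C) - log (priorV π)) + (log k + log l)
        ≈⟨ +-cong (I∞≈log-log π C) (log-* 0<k 0<l) ⟨
      I∞ π C + log (k * l)  ∎

    I∞-×ᵖ : (π₁ : Prior X₁) (π₂ : Prior X₂)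
            (C₁ : Channel X₁ Y₁) (C₂ : Channel X₂ Y₂) →
            I∞ (π₁ ×ᵖ π₂) (C₁ ×ᶜ C₂) ≈ I∞ π₁ C₁ + I∞ π₂ C₂
    I∞-×ᵖ π₁ π₂ C₁ C₂ = begin-equality
      I∞ (π₁ ×ᵖ π₂) (C₁ ×ᶜ C₂)
        ≈⟨ I∞≈log-log (π₁ ×ᵖ π₂) (C₁ ×ᶜ C₂) ⟩
      log (posteriorV (π₁ ×ᵖ π₂) (C₁ ×ᶜ C₂)) - log (priorV (π₁ ×ᵖ π₂))
        ≈⟨ +-cong log-posteriorV (-‿cong log-priorV) ⟩
      (log (posteriorV π₁ C₁) + log (posteriorV π₂ C₂)) -
      (log (priorV π₁) + log (priorV π₂))
        ≈⟨ +-congˡ (⁻¹-∙-comm _ _) ⟨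
      (log (posteriorV π₁ C₁) + log (posteriorV π₂ C₂)) +
      (- log (priorV π₁) - log (priorV π₂))
        ≈⟨ +.interchange _ _ _ _ ⟩
      (log (posteriorV π₁ C₁) - log (priorV π₁)) +
      (log (posteriorV π₂ C₂) - log (priorV π₂))
        ≈⟨ +-cong (I∞≈log-log π₁ C₁) (I∞≈log-log π₂ C₂) ⟨
      I∞ π₁ C₁ + I∞ π₂ C₂  ∎
      where
      log-posteriorV : log (posteriorV (π₁ ×ᵖ π₂) (C₁ ×ᶜ C₂)) ≈
                       log (posteriorV π₁ C₁) + log (posteriorV π₂ C₂)
      log-posteriorV =
        trans (log-cong (posteriorV-pos (π₁ ×ᵖ π₂) (C₁ ×ᶜ C₂))
                        (posteriorV-×ᵖ π₁ π₂ C₁ C₂))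
              (log-* (posteriorV-pos π₁ C₁) (posteriorV-pos π₂ C₂))

      log-priorV : log (priorV (π₁ ×ᵖ π₂)) ≈ log (priorV π₁) + log (priorV π₂)
      log-priorV = trans (log-cong (priorV-pos (π₁ ×ᵖ π₂)) (priorV-×ᵖ π₁ π₂))
                         (log-* (priorV-pos π₁) (priorV-pos π₂))

  -- A joint prior against the product of its marginals.

  module JointPrior {X₁ X₂ : FiniteSet} (π : Prior (X₁ ⊗ X₂)) where

    π₁×π₂ : Prior (X₁ ⊗ X₂)
    π₁×π₂ = marginal₁ π ×ᵖ marginal₂ π

    -- Each marginal is a sum of nonnegative terms, one of which is the positive joint probability.
    ratio-pos : ∀ {x} → Support π x → 0# < ratio π x
    ratio-pos {x₁ , x₂} πx≉0 = *-pos (*-pos 0<π₁ 0<π₂) (⁻¹-pos 0<πx)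
      where
      0<πx = support-pos π πx≉0
      0<π₁ : 0# < prob (marginal₁ π) x₁
      0<π₁ = <-≤-trans 0<πx (≤-∑ X₂ (λ x₂ → prob-nonNeg π (x₁ , x₂)) x₂)
      0<π₂ : 0# < prob (marginal₂ π) x₂
      0<π₂ = <-≤-trans 0<πx (≤-∑ X₁ (λ x₁ → prob-nonNeg π (x₁ , x₂)) x₁)

    private
      ratio₀ : Carrier
      ratio₀ = ratio π (proj₁ (support-nonEmpty π))

      0<ratio₀ : 0# < ratio₀
      0<ratio₀ = ratio-pos (proj₂ (support-nonEmpty π))

      ratios : List.List Carrier
      ratios = List.map (ratio π) (supportList π)

    M-max-pos : 0# < M-max π
    M-max-pos = Extrema.v<max⁺ totalOrder ratio₀ ratios (inj₁ 0<ratio₀)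

    -- A positive seed settles the case of the maximum, but a minimum also needs every listed ratio
    -- to be positive; the filter ensures this by keeping only support points.
    M-min-pos : 0# < M-min π
    M-min-pos = Extrema.v<min⁺ totalOrder 0<ratio₀ (All.map⁺ (All.map ratio-pos
      (All.all-filter (λ x → ¬? (prob π x ≟ 0#))
                      (List.tabulate (FiniteSet.element (X₁ ⊗ X₂))))))

    ratio∈ratios : ∀ {x} → Support π x → ratio π x ∈ ratios
    ratio∈ratios {x} πx≉0 = Membership.∈-map⁺ (ratio π)
      (Membership.∈-filter⁺ (λ x → ¬? (prob π x ≟ 0#))
        (elementwise (X₁ ⊗ X₂) {P = _∈ List.tabulate (FiniteSet.element (X₁ ⊗ X₂))}
          Membership.∈-tabulate⁺ x)
        πx≉0)

    ratio≤M-max : ∀ {x} → Support π x → ratio π x ≤ M-max π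
    ratio≤M-max πx≉0 =
      All.lookup (Extrema.xs≤max totalOrder ratio₀ ratios) (ratio∈ratios πx≉0)

    M-min≤ratio : ∀ {x} → Support π x → M-min π ≤ ratio π x
    M-min≤ratio πx≉0 =
      All.lookup (Extrema.min≤xs totalOrder ratio₀ ratios) (ratio∈ratios πx≉0)

    π₁×π₂≤M-max*π : JointlySupported π → ∀ x → prob π₁×π₂ x ≤ M-max π * prob π x
    π₁×π₂≤M-max*π js x@(x₁ , x₂) with prob π x ≟ 0#
    ... | no πx≉0 = begin
      prob π₁×π₂ x          ≈⟨ y/x*x≈y πx≉0 (prob π₁×π₂ x) ⟨
      ratio π x * prob π x  ≤⟨ *-monoˡ-≤ (prob-nonNeg π x) (ratio≤M-max πx≉0) ⟩
      M-max π * prob π x    ∎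
    -- Joint support speaks of nonvanishing products, so its contrapositive is reached by deciding
    -- whether the product vanishes.
    ... | yes πx≈0 with prob π₁×π₂ x ≟ 0#
    ...   | no  ≉0 = contradiction πx≈0 (js x₁ x₂ ≉0)
    ...   | yes ≈0 = begin
      prob π₁×π₂ x          ≈⟨ ≈0 ⟩
      0#                    ≤⟨ *-nonNeg (proj₁ M-max-pos) (prob-nonNeg π x) ⟩
      M-max π * prob π x    ∎

    -- The constant stands inverted on the right to match the shape of the hypotheses of `I∞-≤`. On
    -- the support the bound is `M-min≤ratio`, multiplied by `prob π x` and divided by `M-min π`.
    π≤M-min⁻¹*π₁×π₂ : ∀ x → prob π x ≤ M-min π ⁻¹ * prob π₁×π₂ x
    π≤M-min⁻¹*π₁×π₂ x with prob π x ≟ 0#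
    ... | no πx≉0 = begin
      prob π x
        ≈⟨ x⁻¹*[x*y]≈y (<⇒≉0 M-min-pos) (prob π x) ⟨
      M-min π ⁻¹ * (M-min π * prob π x)
        ≤⟨ *-monoʳ-≤ (proj₁ (⁻¹-pos M-min-pos))
             (*-monoˡ-≤ (prob-nonNeg π x) (M-min≤ratio πx≉0)) ⟩
      M-min π ⁻¹ * (ratio π x * prob π x)
        ≈⟨ *-congˡ (y/x*x≈y πx≉0 (prob π₁×π₂ x)) ⟩
      M-min π ⁻¹ * prob π₁×π₂ x  ∎
    ... | yes πx≈0 = begin
      prob π x  ≈⟨ πx≈0 ⟩
      0#        ≤⟨ *-nonNeg (proj₁ (⁻¹-pos M-min-pos)) (prob-nonNeg π₁×π₂ x) ⟩
      M-min π ⁻¹ * prob π₁×π₂ x  ∎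

-- Bounds on the leakage of a parallel composition.

corollary4p2 :
    ∀ {c ℓ₁ ℓ₂} (ℝ : Reals c ℓ₁ ℓ₂) (log : Reals.Carrier ℝ → Reals.Carrier ℝ) →
    Reals.IsLog₂ ℝ log →
    let open Reals ℝ
        open Leakage ℝ log
    in
    (X₁ X₂ Y₁ Y₂ : FiniteSet)
    (π : Prior (X₁ ⊗ X₂)) → JointlySupported π →
    (C₁ : Channel X₁ Y₁) (C₂ : Channel X₂ Y₂) →
    let π₁ = marginal₁ π
        π₂ = marginal₂ π
    in
    ((I∞ π₁ C₁ + I∞ π₂ C₂) - log (M-max π / M-min π) ≤ I∞ π (C₁ ×ᶜ C₂)) ×
    (I∞ π (C₁ ×ᶜ C₂) ≤ (I∞ π₁ C₁ + I∞ π₂ C₂) + log (M-max π / M-min π)) ×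
    ((∀ x₁ x₂ → prob π (x₁ , x₂) ≈ prob π₁ x₁ * prob π₂ x₂) →
      I∞ (π₁ ×ᵖ π₂) (C₁ ×ᶜ C₂) ≈ I∞ π₁ C₁ + I∞ π₂ C₂)
corollary4p2 ℝ log isLog₂ X₁ X₂ Y₁ Y₂ π js C₁ C₂ =
    -- The lower bound is proved with the logarithm added on the other side, the form in which
    -- `I∞-≤` delivers it.
    x≤y+z⇒x-z≤y lower , upper , λ _ → additive
  where
  open Reals ℝ
  open RealsProperties ℝ
  open Leakage ℝ log
  open LeakageProperties ℝ log
  open JointPrior π
  open IsLog₂ isLog₂
  open PartialOrderReasoning (DecTotalOrder.poset decTotalOrder)

  π₁ = marginal₁ π
  π₂ = marginal₂ π

  0<M-min⁻¹ : 0# < M-min π ⁻¹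
  0<M-min⁻¹ = ⁻¹-pos M-min-pos

  additive : I∞ π₁×π₂ (C₁ ×ᶜ C₂) ≈ I∞ π₁ C₁ + I∞ π₂ C₂
  additive = I∞-×ᵖ isLog₂ π₁ π₂ C₁ C₂

  lower : I∞ π₁ C₁ + I∞ π₂ C₂ ≤ I∞ π (C₁ ×ᶜ C₂) + log (M-max π / M-min π)
  lower = begin
    I∞ π₁ C₁ + I∞ π₂ C₂
      ≈⟨ additive ⟨
    I∞ π₁×π₂ (C₁ ×ᶜ C₂)
      -- With `k` as `M-max π` and `l` as `M-min π ⁻¹`, the product `k * l` is the quotient by
      -- definition.
      ≤⟨ I∞-≤ isLog₂ π π₁×π₂ (C₁ ×ᶜ C₂) M-max-pos 0<M-min⁻¹
           (π₁×π₂≤M-max*π js) π≤M-min⁻¹*π₁×π₂ ⟩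
    I∞ π (C₁ ×ᶜ C₂) + log (M-max π / M-min π)  ∎

  upper : I∞ π (C₁ ×ᶜ C₂) ≤ (I∞ π₁ C₁ + I∞ π₂ C₂) + log (M-max π / M-min π)
  upper = begin
    I∞ π (C₁ ×ᶜ C₂)
      ≤⟨ I∞-≤ isLog₂ π₁×π₂ π (C₁ ×ᶜ C₂) 0<M-min⁻¹ M-max-pos
           π≤M-min⁻¹*π₁×π₂ (π₁×π₂≤M-max*π js) ⟩
    I∞ π₁×π₂ (C₁ ×ᶜ C₂) + log (M-min π ⁻¹ * M-max π)
      -- Swapping the priors swaps the two constants; commuting them under `log` requires their
      -- product to be positive.
      ≈⟨ +-cong additive (log-cong (*-pos 0<M-min⁻¹ M-max-pos) (*-comm _ _)) ⟩
    (I∞ π₁ C₁ + I∞ π₂ C₂) + log (M-max π / M-min π)  ∎
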